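{- Let $r\ge 0$ and let $T_{\langle3,3,3\rangle}=\sum_{t=1}^{r}A_t\otimes B_t\otimes C_t$ be a decomposition over $\mathbb F_2$ in which all factors $A_t,B_t,C_t\in M_3(\mathbb F_2)$ are nonzero and $\sum_{t=1}^r\operatorname{rank}A_t=27$. Then at most one index $t$ has $A_t$ invertible.
   Context: $V=M_3(\mathbb F_2)$, with row and column indices in $\{0,1,2\}$ and matrix units $E_{ij}$. The $3\times3$ matrix multiplication tensor is $T_{\langle3,3,3\rangle}=\sum_{i,j,k=0}^2E_{ij}\otimes E_{jk}\otimes E_{ik}\in V\otimes V\otimes V$. Here $\operatorname{rank}A_t$ is the matrix rank over $\mathbb F_2$. -}

module Defs where

open import Algebra.Bundles using (CommutativeRing)
open import Data.Bool using (Bool; false; true)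
open import Data.Bool.Properties using (xor-∧-commutativeRing) renaming (_≟_ to _≟ᵇ_)
open import Data.Fin using (Fin; _≟_)
open import Data.Fin.Subset using (Subset; inside; outside; _∉_; ∣_∣)
open import Data.Fin.Subset.Properties using (_∈?_)
open import Data.Fin.Properties using (all?)
open import Data.List as List using (List; _∷_; []; _++_)
open import Data.List.Extrema.Nat using (max)
open import Data.Nat using (ℕ; zero; suc)
open import Data.Nat.Properties using (+-*-semiring)
open import Data.Product using (_×_; _,_; ∃-syntax)
open import Data.Vec using (Vec; _∷_; []; lookup; tabulate; replicate)
open import Data.Vec.Properties using (≡-dec)
open import Relation.Binary.PropositionalEquality using (_≡_)
open import Relation.Nullary using (Dec; yes; no; does)
open import Relation.Nullary.Decidable using (_→-dec_; ¬?)

-- The field with two elements: Bool, with xor as addition and ∧ as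
-- multiplication.
𝔽₂ : Set
𝔽₂ = CommutativeRing.Carrier xor-∧-commutativeRing

open CommutativeRing xor-∧-commutativeRing public
  using (0#; 1#; semiring) renaming (_+_ to _+₂_; _*_ to _*₂_)

open import Algebra.Properties.Semiring.Sum semiring public
  using () renaming (sum to ∑₂)
open import Algebra.Properties.Semiring.Sum +-*-semiring public
  using () renaming (sum to ∑ℕ)

Matrix : ℕ → ℕ → Set
Matrix m n = Vec (Vec 𝔽₂ n) m

V : Set
V = Matrix 3 3

entry : ∀ {m n} → Matrix m n → Fin m → Fin n → 𝔽₂
entry A i j = lookup (lookup A i) j

matrix : ∀ {m n} → (Fin m → Fin n → 𝔽₂) → Matrix m n
matrix f = tabulate λ i → tabulate λ j → f i j

δ : ∀ {n} → Fin n → Fin n → 𝔽₂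
δ i j = does (i ≟ j)

0ᵛ : ∀ {n} → Vec 𝔽₂ n
0ᵛ {n} = replicate n 0#

0ᴹ : ∀ {m n} → Matrix m n
0ᴹ = matrix λ _ _ → 0#

1ᴹ : ∀ {n} → Matrix n n
1ᴹ = matrix δ

infixl 7 _*ᴹ_ _*ᵛ_

_*ᴹ_ : ∀ {l m n} → Matrix l m → Matrix m n → Matrix l n
A *ᴹ B = matrix λ i k → ∑₂ λ j → entry A i j *₂ entry B j k

_*ᵛ_ : ∀ {m n} → Matrix m n → Vec 𝔽₂ n → Vec 𝔽₂ m
A *ᵛ c = tabulate λ i → ∑₂ λ j → entry A i j *₂ lookup c j

Invertible : ∀ {n} → Matrix n n → Set
Invertible {n} A = ∃[ B ] (A *ᴹ B ≡ 1ᴹ {n} × B *ᴹ A ≡ 1ᴹ {n})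

E : ∀ {m n} → Fin m → Fin n → Matrix m n
E i j = matrix λ a b → δ i a *₂ δ j b

-- The columns of A indexed by S are linearly independent; A *ᵛ c is the
-- linear combination of the columns with coefficients c.
IndependentColumns : ∀ {m n} → Matrix m n → Subset n → Set
IndependentColumns A S =
  ∀ c → (∀ j → j ∉ S → lookup c j ≡ 0#) → A *ᵛ c ≡ 0ᵛ → c ≡ 0ᵛ

allVec? : ∀ {n} {P : Vec 𝔽₂ n → Set} → (∀ v → Dec (P v)) → Dec (∀ v → P v)
allVec? {zero} P? with P? []
... | yes p = yes λ { [] → p }
... | no ¬p = no λ f → ¬p (f [])
allVec? {suc n} P? with allVec? (λ v → P? (false ∷ v)) | allVec? (λ v → P? (true ∷ v))
... | yes p | yes q = yes λ { (false ∷ v) → p v ; (true ∷ v) → q v }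
... | no ¬p | _     = no λ f → ¬p λ v → f (false ∷ v)
... | yes _ | no ¬q = no λ f → ¬q λ v → f (true ∷ v)

independentColumns? : ∀ {m n} (A : Matrix m n) (S : Subset n) →
                      Dec (IndependentColumns A S)
independentColumns? A S = allVec? λ c →
  all? (λ j → ¬? (j ∈? S) →-dec (lookup c j ≟ᵇ 0#)) →-dec
  (≡-dec _≟ᵇ_ (A *ᵛ c) 0ᵛ →-dec ≡-dec _≟ᵇ_ c 0ᵛ)

subsets : ∀ n → List (Subset n)
subsets zero    = [] ∷ []
subsets (suc n) = List.map (outside ∷_) (subsets n) ++ List.map (inside ∷_) (subsets n)

-- The maximal number of linearly independent columns. The base value 0 is
-- harmless, as the empty set of columns is independent.
rank : ∀ {m n} → Matrix m n → ℕ
rank {n = n} A = max 0 (List.map ∣_∣ (List.filter (independentColumns? A) (subsets n)))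

-- V ⊗ V ⊗ V in coordinates: t (a , a′) (b , b′) (c , c′) is the coefficient of
-- E a a′ ⊗ E b b′ ⊗ E c c′.
Tensor : Set
Tensor = Fin 3 × Fin 3 → Fin 3 × Fin 3 → Fin 3 × Fin 3 → 𝔽₂

infix 4 _≈ᵀ_

_≈ᵀ_ : Tensor → Tensor → Set
T ≈ᵀ U = ∀ p q s → T p q s ≡ U p q s

infix 8 _⊗_⊗_

_⊗_⊗_ : V → V → V → Tensor
(A ⊗ B ⊗ C) (a , a′) (b , b′) (c , c′) = entry A a a′ *₂ entry B b b′ *₂ entry C c c′

∑ᵀ : ∀ {n} → (Fin n → Tensor) → Tensor
∑ᵀ T p q s = ∑₂ λ t → T t p q s

-- The third factor is E i k, not the E k i of the cyclically symmetric
-- convention.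
T⟨3,3,3⟩ : Tensor
T⟨3,3,3⟩ = ∑ᵀ λ i → ∑ᵀ λ j → ∑ᵀ λ k → E i j ⊗ E j k ⊗ E i k

{-# OPTIONS --safe #-}

-- Regroup the six indices of T⟨3,3,3⟩ into a row (i , k , j) and a column
-- (i′ , k′ , j′), where the first factor has indices (i , j′), the second
-- (j , k) and the third (i′ , k′). This turns the tensor into the 27 × 27
-- identity matrix and A ⊗ B ⊗ C into a matrix of rank rank A, for B, C ≠ 0.
-- Since ∑ rank A_t = 27, rank factorisations of the summands N_t assemble to a
-- product Φ Ψ = 1 of square matrices. Then also Ψ Φ = 1, so the N_t are
-- orthogonal idempotents, which reads A_s B_t C_sᵀ A_t = δ_st A_t.
-- If A_s is invertible, the case s = t makes C_sᵀ invertible; if A_t is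
-- invertible too and s ≠ t, then B_t = 0.
module Submission where

open import Defs
open import Algebra.Properties.Semiring.Sum semiring
  using (sum-cong-≗; ∑-comm; *-distribˡ-sum; *-distribʳ-sum; sum-replicate-zero)
open import Data.Bool using (if_then_else_)
open import Data.Bool.Properties
  using (∧-assoc; ∧-identityʳ; ∧-zeroʳ; xor-assoc; xor-identityʳ; ¬-not)
  renaming (_≟_ to _≟ᵇ_)
open import Data.Bool.Solver using (module xor-∧-Solver)
open import Data.Fin using (Fin; zero; suc; splitAt; _↑ˡ_; _↑ʳ_; punchOut; _≟_)
open import Data.Fin.Properties
  using (any?; all?; injective⇒≤; punchOut-injective; splitAt-↑ˡ; splitAt-↑ʳ; 2↔Bool)
open import Data.Nat using (ℕ; zero; suc; _^_)
open import Data.Nat.Properties using (1+n≰n) renaming (_≟_ to _≟ⁿ_)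
open import Data.Product using (_×_; _,_; ∃-syntax; Σ-syntax; proj₁; proj₂)
import Data.Product as Product
open import Data.Product.Properties using () renaming (≡-dec to ×-≡-dec)
open import Data.Sum using (_⊎_; inj₁; inj₂; [_,_]′)
import Data.Sum as Sum
open import Data.Vec using (Vec; []; _∷_; lookup; map; zipWith; tabulate)
open import Data.Vec.Properties
  using (≡-dec; lookup∘tabulate; tabulate∘lookup; tabulate-cong)
open import Data.Vec.Recursive using (lift↔; Fin[m^n]↔Fin[m]^n)
open import Data.Vec.Recursive.Properties using (↔Vec)
open import Function using (_∘_; id; _↔_; Inverse; Injective)
open import Function.Properties.Inverse using (↔-sym; ↔-trans)
open import Relation.Binary.PropositionalEquality
  using (_≡_; _≢_; refl; sym; trans; cong; cong₂; subst; subst₂; module ≡-Reasoning)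
open import Relation.Nullary using (Dec; yes; no; contradiction)
open import Relation.Nullary.Decidable using (_×-dec_; from-yes; dec-true; dec-false)

open ≡-Reasoning

-- Finite types

-- Pigeonhole: `g` is injective because `f` undoes it, so if it missed `y`, punching `y` out of the
-- codomain would inject `Fin (suc n)` into `Fin n`.
leftInverse⇒rightInverse-Fin : ∀ {n} (f g : Fin n → Fin n) →
  (∀ x → f (g x) ≡ x) → ∀ y → g (f y) ≡ y
leftInverse⇒rightInverse-Fin {suc n} f g f∘g y with any? (λ x → g x ≟ y)
... | yes (x , refl) = cong g (f∘g x)
... | no  y∉g = contradiction (injective⇒≤ punch-injective) 1+n≰n
  where
  y≢ : ∀ x → y ≢ g x
  y≢ x y≡gx = y∉g (x , sym y≡gx)

  punch-injective : Injective _≡_ _≡_ (λ x → punchOut (y≢ x))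
  punch-injective {a} {b} eq = begin
    a       ≡⟨ f∘g a ⟨
    f (g a) ≡⟨ cong f (punchOut-injective (y≢ a) (y≢ b) eq) ⟩
    f (g b) ≡⟨ f∘g b ⟩
    b       ∎

leftInverse⇒rightInverse : ∀ {X : Set} {n} → X ↔ Fin n → (f g : X → X) →
  (∀ x → f (g x) ≡ x) → ∀ y → g (f y) ≡ y
leftInverse⇒rightInverse X↔Fin f g f∘g y = begin
  g (f y)                               ≡⟨ from∘to _ ⟨
  from (to (g (f y)))                   ≡⟨ cong (from ∘ to ∘ g) (from∘to _) ⟨
  from (to (g (from (to (f y)))))       ≡⟨ cong (from ∘ to ∘ g ∘ from ∘ to ∘ f) (from∘to y) ⟨
  from (to (g (from (to (f (from (to y)))))))
    ≡⟨ cong from (leftInverse⇒rightInverse-Fin (to ∘ f ∘ from) (to ∘ g ∘ from) inverse (to y)) ⟩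
  from (to y)                           ≡⟨ from∘to y ⟩
  y                                     ∎
  where
  open Inverse X↔Fin using (to; from)
  from∘to : ∀ x → from (to x) ≡ x
  from∘to = Inverse.strictlyInverseʳ X↔Fin
  to∘from : ∀ i → to (from i) ≡ i
  to∘from = Inverse.strictlyInverseˡ X↔Fin
  inverse : ∀ i → to (f (from (to (g (from i))))) ≡ i
  inverse i = begin
    to (f (from (to (g (from i))))) ≡⟨ cong (to ∘ f) (from∘to _) ⟩
    to (f (g (from i)))             ≡⟨ cong to (f∘g _) ⟩
    to (from i)                     ≡⟨ to∘from i ⟩
    i                               ∎

-- Applied twice, to rows and then to entries, this makes the set of matrices over `𝔽₂` finite.
Vec↔Fin : ∀ {X : Set} {m} n → X ↔ Fin m → Vec X n ↔ Fin (m ^ n)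
Vec↔Fin {m = m} n X↔Fin =
  ↔-trans (↔-sym (↔Vec n)) (↔-trans (lift↔ n X↔Fin) (↔-sym (Fin[m^n]↔Fin[m]^n m n)))

-- Sums

∑-splitAt : ∀ m {n} (f : Fin m ⊎ Fin n → 𝔽₂) →
  ∑₂ (f ∘ splitAt m) ≡ ∑₂ (f ∘ inj₁) +₂ ∑₂ (f ∘ inj₂)
∑-splitAt zero    f = refl
∑-splitAt (suc m) f = trans
  (cong (f (inj₁ zero) +₂_) (∑-splitAt m (f ∘ Sum.map₁ suc)))
  (sym (xor-assoc (f (inj₁ zero)) (∑₂ (f ∘ inj₁ ∘ suc)) (∑₂ (f ∘ inj₂))))

-- Lays the blocks `Fin (ρ t)` end to end, so that a single matrix index can encode a block together
-- with a position in it.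
split : ∀ {r} (ρ : Fin r → ℕ) → Fin (∑ℕ ρ) → Σ[ t ∈ Fin r ] Fin (ρ t)
split {suc r} ρ = [ zero ,_ , Product.map suc id ∘ split (ρ ∘ suc) ]′ ∘ splitAt (ρ zero)

∑-split : ∀ {r} (ρ : Fin r → ℕ) (f : Σ[ t ∈ Fin r ] Fin (ρ t) → 𝔽₂) →
  ∑₂ (f ∘ split ρ) ≡ ∑₂ λ t → ∑₂ λ l → f (t , l)
∑-split {zero}  ρ f = refl
∑-split {suc r} ρ f = trans
  (∑-splitAt (ρ zero) (f ∘ [ zero ,_ , Product.map suc id ∘ split (ρ ∘ suc) ]′))
  (cong (∑₂ (λ l → f (zero , l)) +₂_) (∑-split (ρ ∘ suc) (f ∘ Product.map suc id)))

split-surjective : ∀ {r} (ρ : Fin r → ℕ) t l → ∃[ x ] split ρ x ≡ (t , l)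
split-surjective {suc r} ρ zero l = l ↑ˡ ∑ℕ (ρ ∘ suc) ,
  cong [ zero ,_ , Product.map suc id ∘ split (ρ ∘ suc) ]′ (splitAt-↑ˡ (ρ zero) l _)
split-surjective {suc r} ρ (suc t) l =
  let x , eq = split-surjective (ρ ∘ suc) t l in ρ zero ↑ʳ x , trans
  (cong [ zero ,_ , Product.map suc id ∘ split (ρ ∘ suc) ]′ (splitAt-↑ʳ (ρ zero) _ x))
  (cong (Product.map suc id) eq)

∑-zero : ∀ {n} (f : Fin n → 𝔽₂) → (∀ i → f i ≡ 0#) → ∑₂ f ≡ 0#
∑-zero {n} f f≗0 = trans (sum-cong-≗ f≗0) (sum-replicate-zero n)

∑-δˡ : ∀ {n} (i : Fin n) (f : Fin n → 𝔽₂) → ∑₂ (λ j → δ i j *₂ f j) ≡ f i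
∑-δˡ {suc n} zero    f = trans
  (cong (f zero +₂_) (∑-zero {n} (λ _ → 0#) λ _ → refl)) (xor-identityʳ (f zero))
∑-δˡ         (suc i) f = ∑-δˡ i (f ∘ suc)

∑-δʳ : ∀ {n} (i : Fin n) (f : Fin n → 𝔽₂) → ∑₂ (λ j → f j *₂ δ j i) ≡ f i
∑-δʳ {suc n} zero    f = trans
  (cong₂ _+₂_ (∧-identityʳ (f zero)) (∑-zero (λ j → f (suc j) *₂ 0#) λ j → ∧-zeroʳ (f (suc j))))
  (xor-identityʳ (f zero))
∑-δʳ         (suc i) f = cong₂ _+₂_ (∧-zeroʳ (f zero)) (∑-δʳ i (f ∘ suc))

-- Matrices

entry-matrix : ∀ {m n} (f : Fin m → Fin n → 𝔽₂) i j → entry (matrix f) i j ≡ f i j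
entry-matrix f i j = trans
  (cong (λ v → lookup v j) (lookup∘tabulate (tabulate ∘ f) i)) (lookup∘tabulate (f i) j)

matrix-entry : ∀ {m n} (A : Matrix m n) → matrix (entry A) ≡ A
matrix-entry A = trans (tabulate-cong (tabulate∘lookup ∘ lookup A)) (tabulate∘lookup A)

entry-injective : ∀ {m n} {A B : Matrix m n} → (∀ i j → entry A i j ≡ entry B i j) → A ≡ B
entry-injective {A = A} {B} eq = begin
  A                ≡⟨ matrix-entry A ⟨
  matrix (entry A) ≡⟨ tabulate-cong (tabulate-cong ∘ eq) ⟩
  matrix (entry B) ≡⟨ matrix-entry B ⟩
  B                ∎

entry-*ᴹ : ∀ {l m n} (A : Matrix l m) (B : Matrix m n) i k →
  entry (A *ᴹ B) i k ≡ ∑₂ λ j → entry A i j *₂ entry B j k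
entry-*ᴹ A B = entry-matrix λ i k → ∑₂ λ j → entry A i j *₂ entry B j k

entry-0ᴹ : ∀ {m n} (i : Fin m) (j : Fin n) → entry 0ᴹ i j ≡ 0#
entry-0ᴹ = entry-matrix λ _ _ → 0#

entry-*ᴹ-cong : ∀ {l m n} (A : Matrix l m) (B : Matrix m n) i k (f g : Fin m → 𝔽₂) →
  (∀ j → entry A i j ≡ f j) → (∀ j → entry B j k ≡ g j) →
  entry (A *ᴹ B) i k ≡ ∑₂ λ j → f j *₂ g j
entry-*ᴹ-cong A B i k f g A≗f B≗g =
  trans (entry-*ᴹ A B i k) (sum-cong-≗ λ j → cong₂ _*₂_ (A≗f j) (B≗g j))

*ᴹ-assoc : ∀ {k l m n} (A : Matrix k l) (B : Matrix l m) (C : Matrix m n) →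
  (A *ᴹ B) *ᴹ C ≡ A *ᴹ (B *ᴹ C)
*ᴹ-assoc A B C = entry-injective λ i j → begin
  entry ((A *ᴹ B) *ᴹ C) i j
    ≡⟨ entry-*ᴹ-cong (A *ᴹ B) C i j
        (λ q → ∑₂ λ p → entry A i p *₂ entry B p q) (λ q → entry C q j) (entry-*ᴹ A B i) (λ _ → refl) ⟩
  (∑₂ λ q → (∑₂ λ p → entry A i p *₂ entry B p q) *₂ entry C q j)
    ≡⟨ sum-cong-≗ (λ q → *-distribʳ-sum (entry C q j) (λ p → entry A i p *₂ entry B p q)) ⟩
  (∑₂ λ q → ∑₂ λ p → (entry A i p *₂ entry B p q) *₂ entry C q j)
    ≡⟨ ∑-comm (λ q p → (entry A i p *₂ entry B p q) *₂ entry C q j) ⟩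
  (∑₂ λ p → ∑₂ λ q → (entry A i p *₂ entry B p q) *₂ entry C q j)
    ≡⟨ (sum-cong-≗ λ p → sum-cong-≗ λ q → ∧-assoc (entry A i p) (entry B p q) (entry C q j)) ⟩
  (∑₂ λ p → ∑₂ λ q → entry A i p *₂ (entry B p q *₂ entry C q j))
    ≡⟨ sum-cong-≗ (λ p → *-distribˡ-sum (entry A i p) (λ q → entry B p q *₂ entry C q j)) ⟨
  (∑₂ λ p → entry A i p *₂ ∑₂ λ q → entry B p q *₂ entry C q j)
    ≡⟨ entry-*ᴹ-cong A (B *ᴹ C) i j
        (entry A i) (λ p → ∑₂ λ q → entry B p q *₂ entry C q j) (λ _ → refl) (λ p → entry-*ᴹ B C p j) ⟨
  entry (A *ᴹ (B *ᴹ C)) i j ∎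

*ᴹ-identityˡ : ∀ {m n} (A : Matrix m n) → 1ᴹ *ᴹ A ≡ A
*ᴹ-identityˡ A = entry-injective λ i j → trans
  (entry-*ᴹ-cong 1ᴹ A i j (δ i) (λ k → entry A k j) (entry-matrix δ i) (λ _ → refl))
  (∑-δˡ i (λ k → entry A k j))

*ᴹ-identityʳ : ∀ {m n} (A : Matrix m n) → A *ᴹ 1ᴹ ≡ A
*ᴹ-identityʳ A = entry-injective λ i j → trans
  (entry-*ᴹ-cong A 1ᴹ i j (entry A i) (λ k → δ k j) (λ _ → refl) (λ k → entry-matrix δ k j))
  (∑-δʳ j (entry A i))

*ᴹ-zeroˡ : ∀ {l m n} (A : Matrix m n) → 0ᴹ {l} *ᴹ A ≡ 0ᴹ
*ᴹ-zeroˡ {m = m} A = entry-injective λ i j → trans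
  (entry-*ᴹ-cong 0ᴹ A i j (λ _ → 0#) (λ k → entry A k j) (entry-0ᴹ i) (λ _ → refl))
  (trans (∑-zero (λ (_ : Fin m) → 0#) λ _ → refl) (sym (entry-0ᴹ i j)))

*ᴹ-zeroʳ : ∀ {l m n} (A : Matrix l m) → A *ᴹ 0ᴹ {m} {n} ≡ 0ᴹ
*ᴹ-zeroʳ A = entry-injective λ i j → trans
  (entry-*ᴹ-cong A 0ᴹ i j (entry A i) (λ _ → 0#) (λ _ → refl) (λ k → entry-0ᴹ k j))
  (trans (∑-zero (λ k → entry A i k *₂ 0#) λ k → ∧-zeroʳ (entry A i k)) (sym (entry-0ᴹ i j)))

*ᴹ-cancelˡ : ∀ {l m n} (A : Matrix l m) A′ (M N : Matrix m n) →
  A′ *ᴹ A ≡ 1ᴹ → A *ᴹ M ≡ A *ᴹ N → M ≡ N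
*ᴹ-cancelˡ A A′ M N A′A≡1 AM≡AN = begin
  M               ≡⟨ absorb M ⟨
  A′ *ᴹ (A *ᴹ M)  ≡⟨ cong (A′ *ᴹ_) AM≡AN ⟩
  A′ *ᴹ (A *ᴹ N)  ≡⟨ absorb N ⟩
  N               ∎
  where
  absorb : ∀ L → A′ *ᴹ (A *ᴹ L) ≡ L
  absorb L = trans (sym (*ᴹ-assoc A′ A L)) (trans (cong (_*ᴹ L) A′A≡1) (*ᴹ-identityˡ L))

*ᴹ-cancelʳ : ∀ {l m n} (A : Matrix m n) A′ (M N : Matrix l m) →
  A *ᴹ A′ ≡ 1ᴹ → M *ᴹ A ≡ N *ᴹ A → M ≡ N
*ᴹ-cancelʳ A A′ M N AA′≡1 MA≡NA = begin
  M               ≡⟨ absorb M ⟨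
  (M *ᴹ A) *ᴹ A′  ≡⟨ cong (_*ᴹ A′) MA≡NA ⟩
  (N *ᴹ A) *ᴹ A′  ≡⟨ absorb N ⟩
  N               ∎
  where
  absorb : ∀ L → (L *ᴹ A) *ᴹ A′ ≡ L
  absorb L = trans (*ᴹ-assoc L A A′) (trans (cong (L *ᴹ_) AA′≡1) (*ᴹ-identityʳ L))

-- Left multiplications by A and by B act on the finite set of n × n matrices,
-- where a left inverse is a right inverse by pigeonhole.
*ᴹ≡1ᴹ-comm : ∀ {m n} → n ≡ m → (A : Matrix m n) (B : Matrix n m) →
  A *ᴹ B ≡ 1ᴹ → B *ᴹ A ≡ 1ᴹ
*ᴹ≡1ᴹ-comm {n} refl A B AB≡1 = begin
  B *ᴹ A         ≡⟨ cong (B *ᴹ_) (*ᴹ-identityʳ A) ⟨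
  B *ᴹ (A *ᴹ 1ᴹ)
    ≡⟨ leftInverse⇒rightInverse (Vec↔Fin n (Vec↔Fin n (↔-sym 2↔Bool))) (A *ᴹ_) (B *ᴹ_) A∘B 1ᴹ ⟩
  1ᴹ             ∎
  where
  A∘B : ∀ M → A *ᴹ (B *ᴹ M) ≡ M
  A∘B M = trans (sym (*ᴹ-assoc A B M)) (trans (cong (_*ᴹ M) AB≡1) (*ᴹ-identityˡ M))

≢0ᴹ⇒∃entry : ∀ {m n} {A : Matrix m n} → A ≢ 0ᴹ → ∃[ i ] ∃[ j ] entry A i j ≡ 1#
≢0ᴹ⇒∃entry {A = A} A≢0 with any? (λ i → any? (λ j → entry A i j ≟ᵇ 1#))
... | yes p = p
... | no ∄1 = contradiction
  (entry-injective λ i j → trans (¬-not λ eq → ∄1 (i , j , eq)) (sym (entry-0ᴹ i j))) A≢0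

-- Transposition and row scaling

_ᵀ : ∀ {m n} → Matrix m n → Matrix n m
A ᵀ = matrix λ i j → entry A j i

infixl 7 _·ᴹ_

-- The product of the diagonal matrix diag(e) with `A`: an indicator function `e` selects rows, a
-- constant `e` is a scalar.
_·ᴹ_ : ∀ {m n} → (Fin m → 𝔽₂) → Matrix m n → Matrix m n
e ·ᴹ A = matrix λ i j → e i *₂ entry A i j

entry-·ᴹ : ∀ {m n} (e : Fin m → 𝔽₂) (A : Matrix m n) i j →
  entry (e ·ᴹ A) i j ≡ e i *₂ entry A i j
entry-·ᴹ e A = entry-matrix λ i j → e i *₂ entry A i j

·ᴹ-*ᴹ-assoc : ∀ {l m n} (e : Fin l → 𝔽₂) (A : Matrix l m) (B : Matrix m n) →
  (e ·ᴹ A) *ᴹ B ≡ e ·ᴹ (A *ᴹ B)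
·ᴹ-*ᴹ-assoc e A B = entry-injective λ i j → begin
  entry ((e ·ᴹ A) *ᴹ B) i j
    ≡⟨ entry-*ᴹ-cong (e ·ᴹ A) B i j (λ k → e i *₂ entry A i k) (λ k → entry B k j)
         (entry-·ᴹ e A i) (λ _ → refl) ⟩
  (∑₂ λ k → (e i *₂ entry A i k) *₂ entry B k j)
    ≡⟨ sum-cong-≗ (λ k → ∧-assoc (e i) (entry A i k) (entry B k j)) ⟩
  (∑₂ λ k → e i *₂ (entry A i k *₂ entry B k j))
    ≡⟨ *-distribˡ-sum (e i) (λ k → entry A i k *₂ entry B k j) ⟨
  e i *₂ (∑₂ λ k → entry A i k *₂ entry B k j)
    ≡⟨ cong (e i *₂_) (entry-*ᴹ A B i j) ⟨
  e i *₂ entry (A *ᴹ B) i j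
    ≡⟨ entry-·ᴹ e (A *ᴹ B) i j ⟨
  entry (e ·ᴹ (A *ᴹ B)) i j ∎

-- The idempotents of a resolution Φ Ψ = 1 of the identity

δ-orthogonal : ∀ {n} (i j k : Fin n) → δ i k *₂ δ j k ≡ δ i j *₂ δ j k
δ-orthogonal i j k with j ≟ k
... | yes refl = refl
... | no _     = trans (∧-zeroʳ (δ i k)) (sym (∧-zeroʳ (δ i j)))

module _ {m n r} (n≡m : n ≡ m) (Φ : Matrix m n) (Ψ : Matrix n m) (ΦΨ≡1 : Φ *ᴹ Ψ ≡ 1ᴹ)
         (τ : Fin n → Fin r) where

  -- With D_t the diagonal projection onto the inner indices that `τ` sends to `t`, this is Φ D_t Ψ.
  -- The blocks add up to Φ Ψ = 1.
  block : Fin r → Matrix m m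
  block t = Φ *ᴹ ((δ t ∘ τ) ·ᴹ Ψ)

  entry-block : ∀ t (f : Fin n → 𝔽₂) (g : Fin n → 𝔽₂) i j →
    (∀ l → entry Φ i l ≡ f l) → (∀ l → entry Ψ l j ≡ g l) →
    entry (block t) i j ≡ ∑₂ λ l → δ t (τ l) *₂ (f l *₂ g l)
  entry-block t f g i j Φ≗f Ψ≗g = trans
    (entry-*ᴹ-cong Φ ((δ t ∘ τ) ·ᴹ Ψ) i j f (λ l → δ t (τ l) *₂ g l) Φ≗f
      (λ l → trans (entry-·ᴹ (δ t ∘ τ) Ψ l j) (cong (δ t (τ l) *₂_) (Ψ≗g l))))
    (sum-cong-≗ λ l → swap (f l) (δ t (τ l)) (g l))
    where
    open xor-∧-Solver
    swap : ∀ x y z → x *₂ (y *₂ z) ≡ y *₂ (x *₂ z)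
    swap = solve 3 (λ x y z → x :* (y :* z) := y :* (x :* z)) refl

  -- In Φ D_s Ψ Φ D_t Ψ the inner Ψ Φ is 1, and D_s D_t = δ_st D_t.
  block-orthogonal : ∀ s t → block s *ᴹ block t ≡ (λ _ → δ s t) ·ᴹ block t
  block-orthogonal s t = begin
    block s *ᴹ block t
      ≡⟨ *ᴹ-assoc Φ ((δ s ∘ τ) ·ᴹ Ψ) (block t) ⟩
    Φ *ᴹ (((δ s ∘ τ) ·ᴹ Ψ) *ᴹ block t)
      ≡⟨ cong (Φ *ᴹ_) (·ᴹ-*ᴹ-assoc (δ s ∘ τ) Ψ (block t)) ⟩
    Φ *ᴹ ((δ s ∘ τ) ·ᴹ (Ψ *ᴹ block t))
      ≡⟨ cong (λ M → Φ *ᴹ ((δ s ∘ τ) ·ᴹ M)) absorb ⟩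
    Φ *ᴹ ((δ s ∘ τ) ·ᴹ ((δ t ∘ τ) ·ᴹ Ψ))
      ≡⟨ entry-injective scale ⟩
    (λ _ → δ s t) ·ᴹ block t ∎
    where
    absorb : Ψ *ᴹ block t ≡ (δ t ∘ τ) ·ᴹ Ψ
    absorb = begin
      Ψ *ᴹ block t                 ≡⟨ *ᴹ-assoc Ψ Φ ((δ t ∘ τ) ·ᴹ Ψ) ⟨
      -- Here Φ and Ψ have to be square: only then does Φ Ψ = 1 give Ψ Φ = 1.
      (Ψ *ᴹ Φ) *ᴹ ((δ t ∘ τ) ·ᴹ Ψ) ≡⟨ cong (_*ᴹ ((δ t ∘ τ) ·ᴹ Ψ)) (*ᴹ≡1ᴹ-comm n≡m Φ Ψ ΦΨ≡1) ⟩
      1ᴹ *ᴹ ((δ t ∘ τ) ·ᴹ Ψ)       ≡⟨ *ᴹ-identityˡ ((δ t ∘ τ) ·ᴹ Ψ) ⟩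
      (δ t ∘ τ) ·ᴹ Ψ               ∎

    rearrange : ∀ u v w x y → w *₂ v ≡ u *₂ v → x *₂ (w *₂ (v *₂ y)) ≡ u *₂ (v *₂ (x *₂ y))
    rearrange u v w x y wv≡uv = begin
      x *₂ (w *₂ (v *₂ y)) ≡⟨ solve 4 (λ v w x y → x :* (w :* (v :* y)) := (w :* v) :* (x :* y)) refl v w x y ⟩
      (w *₂ v) *₂ (x *₂ y) ≡⟨ cong (_*₂ (x *₂ y)) wv≡uv ⟩
      (u *₂ v) *₂ (x *₂ y) ≡⟨ ∧-assoc u v (x *₂ y) ⟩
      u *₂ (v *₂ (x *₂ y)) ∎
      where open xor-∧-Solver

    scale : ∀ i j → entry (Φ *ᴹ ((δ s ∘ τ) ·ᴹ ((δ t ∘ τ) ·ᴹ Ψ))) i j ≡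
                    entry ((λ _ → δ s t) ·ᴹ block t) i j
    scale i j = begin
      entry (Φ *ᴹ ((δ s ∘ τ) ·ᴹ ((δ t ∘ τ) ·ᴹ Ψ))) i j
        ≡⟨ entry-*ᴹ-cong Φ ((δ s ∘ τ) ·ᴹ ((δ t ∘ τ) ·ᴹ Ψ)) i j
             (entry Φ i) (λ l → δ s (τ l) *₂ (δ t (τ l) *₂ entry Ψ l j)) (λ _ → refl)
             (λ l → trans (entry-·ᴹ (δ s ∘ τ) ((δ t ∘ τ) ·ᴹ Ψ) l j)
                          (cong (δ s (τ l) *₂_) (entry-·ᴹ (δ t ∘ τ) Ψ l j))) ⟩
      (∑₂ λ l → entry Φ i l *₂ (δ s (τ l) *₂ (δ t (τ l) *₂ entry Ψ l j)))
        ≡⟨ sum-cong-≗ (λ l → rearrange (δ s t) (δ t (τ l)) (δ s (τ l)) (entry Φ i l) (entry Ψ l j)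
                               (δ-orthogonal s t (τ l))) ⟩
      (∑₂ λ l → δ s t *₂ (δ t (τ l) *₂ (entry Φ i l *₂ entry Ψ l j)))
        ≡⟨ *-distribˡ-sum (δ s t) (λ l → δ t (τ l) *₂ (entry Φ i l *₂ entry Ψ l j)) ⟨
      δ s t *₂ (∑₂ λ l → δ t (τ l) *₂ (entry Φ i l *₂ entry Ψ l j))
        ≡⟨ cong (δ s t *₂_)
             (entry-block t (entry Φ i) (λ l → entry Ψ l j) i j (λ _ → refl) (λ _ → refl)) ⟨
      δ s t *₂ entry (block t) i j
        ≡⟨ entry-·ᴹ (λ _ → δ s t) (block t) i j ⟨
      entry ((λ _ → δ s t) ·ᴹ block t) i j ∎

-- Rank factorisation

-- Gaussian elimination on rows. A nonzero first row `u` with pivot column `j` becomes a row of the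
-- right factor and is added to each later row with a 1 in column `j`; those entries form the
-- matching column of the left factor. A zero row contributes a zero row on the left.
eliminate : ∀ {m n} → Matrix m n → ∃[ k ] Matrix m k × Matrix k n
eliminate [] = 0 , [] , []
eliminate (u ∷ A) with any? (λ j → lookup u j ≟ᵇ 1#)
... | no _ = let k , X , Y = eliminate A in k , 0ᵛ ∷ X , Y
... | yes (j , _) =
  let k , X , Y = eliminate (map (λ v → if lookup v j then zipWith _+₂_ v u else v) A)
  in suc k , (1# ∷ 0ᵛ) ∷ zipWith _∷_ (map (λ v → lookup v j) A) X , u ∷ Y

IsRankFactorization : ∀ {m n} → Matrix m n → ∃[ k ] Matrix m k × Matrix k n → Set
IsRankFactorization A (k , X , Y) = k ≡ rank A × A ≡ X *ᴹ Y

isRankFactorization? : ∀ {m n} (A : Matrix m n) F → Dec (IsRankFactorization A F)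
isRankFactorization? A (k , X , Y) = (k ≟ⁿ rank A) ×-dec ≡-dec (≡-dec _≟ᵇ_) A (X *ᴹ Y)

-- Checked by evaluation on all 512 matrices; this is where the number of pivot rows is matched with
-- the column rank `rank`.
eliminate-isRankFactorization : ∀ u v w →
  let A = u ∷ v ∷ w ∷ [] in IsRankFactorization {3} {3} A (eliminate A)
eliminate-isRankFactorization = from-yes
  (allVec? λ u → allVec? λ v → allVec? λ w →
    let A = u ∷ v ∷ w ∷ [] in isRankFactorization? {3} {3} A (eliminate A))

rankFactorization : (A : V) →
  ∃[ X ] ∃[ Y ] A ≡ _*ᴹ_ {3} {rank A} {3} X Y
rankFactorization A@(u ∷ v ∷ w ∷ []) =
  let k≡rank , A≡XY = eliminate-isRankFactorization u v w
      _ , X , Y = eliminate A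
  in subst (λ k → ∃[ X ] ∃[ Y ] A ≡ _*ᴹ_ {3} {k} {3} X Y) k≡rank (X , Y , A≡XY)

-- The flattening of T⟨3,3,3⟩

-- The number n³, written as an iterated sum so that `split` can decode it twice. `cube 3` evaluates
-- to 27.
cube : ℕ → ℕ
cube n = ∑ℕ {n} λ _ → ∑ℕ {n} λ _ → n

Index : ℕ → Set
Index n = Fin n × Fin n × Fin n

ι : ∀ {n} → Fin (cube n) → Index n
ι {n} a = let i , b = split {n} _ a in i , split {n} _ b

∑-ι : ∀ {n} (f : Index n → 𝔽₂) → ∑₂ (f ∘ ι {n}) ≡ ∑₂ λ i → ∑₂ λ k → ∑₂ λ j → f (i , k , j)
∑-ι {n} f = trans
  (∑-split {n} (λ _ → ∑ℕ {n} λ _ → n) λ (i , b) → f (i , split {n} (λ _ → n) b))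
  (sum-cong-≗ λ i → ∑-split {n} (λ _ → n) λ kj → f (i , kj))

ι-surjective : ∀ {n} i k j → ∃[ a ] ι {n} a ≡ (i , k , j)
ι-surjective {n} i k j =
  let b , b≡ = split-surjective {n} (λ _ → n) k j
      a , a≡ = split-surjective {n} (λ _ → ∑ℕ {n} λ _ → n) i b
  in a , trans (cong (λ (i , b) → i , split {n} _ b) a≡) (cong (i ,_) b≡)

-- Up to the order of indices, the Kronecker product of `A` with the rank-one matrix vec(B) vec(C)ᵀ.
flatten : ∀ {n} (A B C : Matrix n n) → Index n → Index n → 𝔽₂
flatten A B C (i , k , j) (i′ , k′ , j′) = entry A i j′ *₂ entry B j k *₂ entry C i′ k′

flattenᵀ : Tensor → Index 3 → Index 3 → 𝔽₂
flattenᵀ T (i , k , j) (i′ , k′ , j′) = T (i , j′) (j , k) (i′ , k′)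

-- The coefficient at (i, j′), (j, k), (i′, k′) is 1 exactly when i = i′, j = j′ and k = k′. All 27
-- × 27 entries are evaluated.
flatten-T⟨3,3,3⟩ : ∀ a b → flattenᵀ T⟨3,3,3⟩ (ι {3} a) (ι {3} b) ≡ δ a b
flatten-T⟨3,3,3⟩ = from-yes (all? λ a → all? λ b →
  flattenᵀ T⟨3,3,3⟩ (ι {3} a) (ι {3} b) ≟ᵇ δ a b)

-- Products of flattenings

contract : ∀ {n} (A B C A′ : Matrix n n) → Matrix n n
contract A B C A′ = ((A *ᴹ B) *ᴹ C ᵀ) *ᴹ A′

entry-contract : ∀ {n} (A B C A′ : Matrix n n) i j → entry (contract A B C A′) i j ≡
  ∑₂ λ p → ∑₂ λ m → ∑₂ λ q → ((entry A i q *₂ entry B q m) *₂ entry C p m) *₂ entry A′ p j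
entry-contract {n} A B C A′ i j = begin
  entry (contract A B C A′) i j
    ≡⟨ entry-*ᴹ-cong ((A *ᴹ B) *ᴹ C ᵀ) A′ i j (λ p → ∑₂ (ABC p)) (λ p → entry A′ p j)
         entry-ABC (λ _ → refl) ⟩
  (∑₂ λ p → ∑₂ (ABC p) *₂ entry A′ p j)
    ≡⟨ sum-cong-≗ (λ p → *-distribʳ-sum (entry A′ p j) (ABC p)) ⟩
  (∑₂ λ p → ∑₂ λ m → ABC p m *₂ entry A′ p j)
    ≡⟨ (sum-cong-≗ λ p → sum-cong-≗ λ m → cong (_*₂ entry A′ p j)
        (*-distribʳ-sum (entry C p m) (AB m))) ⟩
  (∑₂ λ p → ∑₂ λ m → (∑₂ λ q → AB m q *₂ entry C p m) *₂ entry A′ p j)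
    ≡⟨ (sum-cong-≗ λ p → sum-cong-≗ λ m →
        *-distribʳ-sum (entry A′ p j) (λ q → AB m q *₂ entry C p m)) ⟩
  (∑₂ λ p → ∑₂ λ m → ∑₂ λ q → (AB m q *₂ entry C p m) *₂ entry A′ p j) ∎
  where
  AB : Fin n → Fin n → 𝔽₂
  AB m q = entry A i q *₂ entry B q m
  ABC : Fin n → Fin n → 𝔽₂
  ABC p m = ∑₂ (AB m) *₂ entry C p m

  entry-ABC : ∀ p → entry ((A *ᴹ B) *ᴹ C ᵀ) i p ≡ ∑₂ (ABC p)
  entry-ABC p = entry-*ᴹ-cong (A *ᴹ B) (C ᵀ) i p (∑₂ ∘ AB) (entry C p)
    (entry-*ᴹ A B i) (λ m → entry-matrix (λ i j → entry C j i) m p)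

-- The scalars `b` and `c` stand for the two entries in a product of flattenings that do not depend
-- on the summed index.
∑-contract : ∀ {n} (A B C A′ : Matrix n n) b c i j →
  (∑₂ λ p → ∑₂ λ m → ∑₂ λ q →
    (entry A i q *₂ b *₂ entry C p m) *₂ (entry A′ p j *₂ entry B q m *₂ c)) ≡
  (b *₂ c) *₂ entry (contract A B C A′) i j
∑-contract {n} A B C A′ b c i j = begin
  (∑₂ λ p → ∑₂ λ m → ∑₂ λ q →
    (entry A i q *₂ b *₂ entry C p m) *₂ (entry A′ p j *₂ entry B q m *₂ c))
    ≡⟨ (sum-cong-≗ λ p → sum-cong-≗ λ m → sum-cong-≗ λ q →
        rearrange (entry A i q) b (entry C p m) (entry A′ p j) (entry B q m) c) ⟩
  (∑₂ λ p → ∑₂ λ m → ∑₂ λ q → (b *₂ c) *₂ y p m q)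
    ≡⟨ (sum-cong-≗ λ p → sum-cong-≗ λ m → *-distribˡ-sum (b *₂ c) (y p m)) ⟨
  (∑₂ λ p → ∑₂ λ m → (b *₂ c) *₂ ∑₂ (y p m))
    ≡⟨ (sum-cong-≗ λ p → *-distribˡ-sum (b *₂ c) (λ m → ∑₂ (y p m))) ⟨
  (∑₂ λ p → (b *₂ c) *₂ ∑₂ λ m → ∑₂ (y p m))
    ≡⟨ *-distribˡ-sum (b *₂ c) (λ p → ∑₂ λ m → ∑₂ (y p m)) ⟨
  (b *₂ c) *₂ (∑₂ λ p → ∑₂ λ m → ∑₂ (y p m))
    ≡⟨ cong ((b *₂ c) *₂_) (entry-contract A B C A′ i j) ⟨
  (b *₂ c) *₂ entry (contract A B C A′) i j ∎
  where
  y : Fin n → Fin n → Fin n → 𝔽₂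
  y p m q = ((entry A i q *₂ entry B q m) *₂ entry C p m) *₂ entry A′ p j

  open xor-∧-Solver
  rearrange : ∀ a b c a′ b′ c′ →
    (a *₂ b *₂ c) *₂ (a′ *₂ b′ *₂ c′) ≡ (b *₂ c′) *₂ (((a *₂ b′) *₂ c) *₂ a′)
  rearrange = solve 6 (λ a b c a′ b′ c′ →
    (a :* b :* c) :* (a′ :* b′ :* c′) := (b :* c′) :* (((a :* b′) :* c) :* a′)) refl

-- The inner triple (p, m, q) is a column of the left flattening, where it enters A_iq and C_pm, and
-- a row of the right one, where it enters A′_pj′ and B′_qm. Summing it out chains these into A B′
-- Cᵀ A′; the entries of `B` and `C′` remain as scalars.
∑-flatten-* : ∀ {n} (A B C A′ B′ C′ : Matrix n n) i k j i′ k′ j′ →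
  ∑₂ (λ c → flatten A B C (i , k , j) (ι c) *₂ flatten A′ B′ C′ (ι c) (i′ , k′ , j′)) ≡
  (entry B j k *₂ entry C′ i′ k′) *₂ entry (contract A B′ C A′) i j′
∑-flatten-* A B C A′ B′ C′ i k j i′ k′ j′ = trans
  (∑-ι λ c → flatten A B C (i , k , j) c *₂ flatten A′ B′ C′ c (i′ , k′ , j′))
  (∑-contract A B′ C A′ (entry B j k) (entry C′ i′ k′) i j′)

-- The flattened summands as orthogonal idempotents

module _ {n r} (A B C : Fin r → Matrix n n)
         (∑flatten≡δ : ∀ a b → ∑₂ (λ t → flatten (A t) (B t) (C t) (ι a) (ι b)) ≡ δ a b)
         (ρ : Fin r → ℕ) (X : ∀ t → Matrix n (ρ t)) (Y : ∀ t → Matrix (ρ t) n)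
         (A≡XY : ∀ t → A t ≡ X t *ᴹ Y t) (∑ρ≡n³ : ∑ℕ ρ ≡ cube n) where

  private
    -- For fixed (t, l) this is column `l` of `X t` tensored with vec(B_t); `ψ` is likewise row `l`
    -- of `Y t` tensored with vec(C_t).
    φ : Index n → Σ[ t ∈ Fin r ] Fin (ρ t) → 𝔽₂
    φ (i , k , j) (t , l) = entry (X t) i l *₂ entry (B t) j k

    ψ : Σ[ t ∈ Fin r ] Fin (ρ t) → Index n → 𝔽₂
    ψ (t , l) (i , k , j) = entry (Y t) l j *₂ entry (C t) i k

    Φ : Matrix (cube n) (∑ℕ ρ)
    Φ = matrix λ a x → φ (ι a) (split ρ x)

    Ψ : Matrix (∑ℕ ρ) (cube n)
    Ψ = matrix λ x b → ψ (split ρ x) (ι b)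

    entry-Φ : ∀ a x → entry Φ a x ≡ φ (ι a) (split ρ x)
    entry-Φ = entry-matrix λ a x → φ (ι a) (split ρ x)

    entry-Ψ : ∀ x b → entry Ψ x b ≡ ψ (split ρ x) (ι b)
    entry-Ψ = entry-matrix λ x b → ψ (split ρ x) (ι b)

    τ : Fin (∑ℕ ρ) → Fin r
    τ = proj₁ ∘ split ρ

    ∑-φψ : ∀ t a b → ∑₂ (λ l → φ a (t , l) *₂ ψ (t , l) b) ≡ flatten (A t) (B t) (C t) a b
    ∑-φψ t (i , k , j) (i′ , k′ , j′) = begin
      (∑₂ λ l → (x l *₂ b) *₂ (y l *₂ c))
        ≡⟨ sum-cong-≗ (λ l → rearrange (x l) b (y l) c) ⟩
      (∑₂ λ l → (x l *₂ y l) *₂ (b *₂ c))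
        ≡⟨ *-distribʳ-sum (b *₂ c) (λ l → x l *₂ y l) ⟨
      (∑₂ λ l → x l *₂ y l) *₂ (b *₂ c)
        ≡⟨ cong (_*₂ (b *₂ c)) (entry-*ᴹ (X t) (Y t) i j′) ⟨
      entry (X t *ᴹ Y t) i j′ *₂ (b *₂ c)
        ≡⟨ cong (λ M → entry M i j′ *₂ (b *₂ c)) (A≡XY t) ⟨
      entry (A t) i j′ *₂ (b *₂ c)
        ≡⟨ ∧-assoc (entry (A t) i j′) b c ⟨
      entry (A t) i j′ *₂ b *₂ c ∎
      where
      x y : Fin (ρ t) → 𝔽₂
      x l = entry (X t) i l
      y l = entry (Y t) l j′
      b c : 𝔽₂
      b = entry (B t) j k
      c = entry (C t) i′ k′

      open xor-∧-Solver
      rearrange : ∀ x b y c → (x *₂ b) *₂ (y *₂ c) ≡ (x *₂ y) *₂ (b *₂ c)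
      rearrange = solve 4 (λ x b y c → (x :* b) :* (y :* c) := (x :* y) :* (b :* c)) refl

    ΦΨ≡1 : Φ *ᴹ Ψ ≡ 1ᴹ
    ΦΨ≡1 = entry-injective λ a b → begin
      entry (Φ *ᴹ Ψ) a b
        ≡⟨ entry-*ᴹ-cong Φ Ψ a b (λ x → φ (ι a) (split ρ x)) (λ x → ψ (split ρ x) (ι b))
             (entry-Φ a) (λ x → entry-Ψ x b) ⟩
      (∑₂ λ x → φ (ι a) (split ρ x) *₂ ψ (split ρ x) (ι b))
        ≡⟨ ∑-split ρ (λ x → φ (ι a) x *₂ ψ x (ι b)) ⟩
      (∑₂ λ t → ∑₂ λ l → φ (ι a) (t , l) *₂ ψ (t , l) (ι b))
        -- Grouped by `t`, the inner sum multiplies out the rank factorisation of the t-th flattened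
        -- summand.
        ≡⟨ sum-cong-≗ (λ t → ∑-φψ t (ι a) (ι b)) ⟩
      (∑₂ λ t → flatten (A t) (B t) (C t) (ι a) (ι b))
        ≡⟨ ∑flatten≡δ a b ⟩
      δ a b
        ≡⟨ entry-matrix δ a b ⟨
      entry 1ᴹ a b ∎

    N : Fin r → Matrix (cube n) (cube n)
    N = block ∑ρ≡n³ Φ Ψ ΦΨ≡1 τ

    -- The projection onto block `t` keeps only the inner indices (t, l), and these multiply out to
    -- the t-th summand.
    entry-N : ∀ t a b → entry (N t) a b ≡ flatten (A t) (B t) (C t) (ι a) (ι b)
    entry-N t a b = begin
      entry (N t) a b
        ≡⟨ entry-block ∑ρ≡n³ Φ Ψ ΦΨ≡1 τ t
             (λ x → φ (ι a) (split ρ x)) (λ x → ψ (split ρ x) (ι b)) a b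
             (entry-Φ a) (λ x → entry-Ψ x b) ⟩
      (∑₂ λ x → δ t (τ x) *₂ (φ (ι a) (split ρ x) *₂ ψ (split ρ x) (ι b)))
        ≡⟨ ∑-split ρ (λ x → δ t (proj₁ x) *₂ (φ (ι a) x *₂ ψ x (ι b))) ⟩
      (∑₂ λ s → ∑₂ λ l → δ t s *₂ φψ s l)
        ≡⟨ sum-cong-≗ (λ s → *-distribˡ-sum (δ t s) (φψ s)) ⟨
      (∑₂ λ s → δ t s *₂ ∑₂ (φψ s))
        ≡⟨ ∑-δˡ t (λ s → ∑₂ (φψ s)) ⟩
      ∑₂ (φψ t)
        ≡⟨ ∑-φψ t (ι a) (ι b) ⟩
      flatten (A t) (B t) (C t) (ι a) (ι b) ∎
      where
      φψ : ∀ s → Fin (ρ s) → 𝔽₂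
      φψ s l = φ (ι a) (s , l) *₂ ψ (s , l) (ι b)

    flatten-orthogonal : ∀ s t a b →
      ∑₂ (λ c → flatten (A s) (B s) (C s) (ι a) (ι c) *₂ flatten (A t) (B t) (C t) (ι c) (ι b)) ≡
      δ s t *₂ flatten (A t) (B t) (C t) (ι a) (ι b)
    flatten-orthogonal s t a b = begin
      (∑₂ λ c → flatten (A s) (B s) (C s) (ι a) (ι c) *₂ flatten (A t) (B t) (C t) (ι c) (ι b))
        ≡⟨ entry-*ᴹ-cong (N s) (N t) a b
             (λ c → flatten (A s) (B s) (C s) (ι a) (ι c)) (λ c → flatten (A t) (B t) (C t) (ι c) (ι b))
             (entry-N s a) (λ c → entry-N t c b) ⟨
      entry (N s *ᴹ N t) a b
        ≡⟨ cong (λ M → entry M a b) (block-orthogonal ∑ρ≡n³ Φ Ψ ΦΨ≡1 τ s t) ⟩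
      entry ((λ _ → δ s t) ·ᴹ N t) a b
        ≡⟨ entry-·ᴹ (λ _ → δ s t) (N t) a b ⟩
      δ s t *₂ entry (N t) a b
        ≡⟨ cong (δ s t *₂_) (entry-N t a b) ⟩
      δ s t *₂ flatten (A t) (B t) (C t) (ι a) (ι b) ∎

  -- The relation N_s N_t = δ_st N_t with both sides computed entrywise. Surjectivity of `ι` makes
  -- all six indices arbitrary.
  contract-orthogonal : ∀ s t i k j i′ k′ j′ →
    (entry (B s) j k *₂ entry (C t) i′ k′) *₂ entry (contract (A s) (B t) (C s) (A t)) i j′ ≡
    δ s t *₂ (entry (A t) i j′ *₂ entry (B t) j k *₂ entry (C t) i′ k′)
  contract-orthogonal s t i k j i′ k′ j′ =
    let a , ιa≡ = ι-surjective i k j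
        b , ιb≡ = ι-surjective i′ k′ j′
    in trans
      (sym (∑-flatten-* (A s) (B s) (C s) (A t) (B t) (C t) i k j i′ k′ j′))
      (subst₂ Orthogonal ιa≡ ιb≡ (flatten-orthogonal s t a b))
    where
    Orthogonal : Index n → Index n → Set
    Orthogonal a b =
      ∑₂ (λ c → flatten (A s) (B s) (C s) a (ι c) *₂ flatten (A t) (B t) (C t) (ι c) b) ≡
      δ s t *₂ flatten (A t) (B t) (C t) a b

  -- Matrix relations and invertible first factors

  module _ (B≢0 : ∀ t → B t ≢ 0ᴹ) (C≢0 : ∀ t → C t ≢ 0ᴹ) where

    contract-diagonal : ∀ t → contract (A t) (B t) (C t) (A t) ≡ A t
    contract-diagonal t = entry-injective λ i j →
      -- The free indices are placed at entries equal to 1, so the scalar factors disappear from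
      -- both sides.
      let q , k , B≡1 = ≢0ᴹ⇒∃entry (B≢0 t)
          p , m , C≡1 = ≢0ᴹ⇒∃entry (C≢0 t)
          K = contract (A t) (B t) (C t) (A t)
      in begin
      entry K i j
        ≡⟨ cong₂ (λ b c → (b *₂ c) *₂ entry K i j) B≡1 C≡1 ⟨
      (entry (B t) q k *₂ entry (C t) p m) *₂ entry K i j
        ≡⟨ contract-orthogonal t t i k q p m j ⟩
      δ t t *₂ (entry (A t) i j *₂ entry (B t) q k *₂ entry (C t) p m)
        ≡⟨ cong (_*₂ (entry (A t) i j *₂ entry (B t) q k *₂ entry (C t) p m)) (dec-true (t ≟ t) refl) ⟩
      entry (A t) i j *₂ entry (B t) q k *₂ entry (C t) p m
        ≡⟨ cong₂ (λ b c → entry (A t) i j *₂ b *₂ c) B≡1 C≡1 ⟩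
      entry (A t) i j *₂ 1# *₂ 1#
        ≡⟨ trans (∧-identityʳ (entry (A t) i j *₂ 1#)) (∧-identityʳ (entry (A t) i j)) ⟩
      entry (A t) i j ∎

    contract-offDiagonal : ∀ {s t} → s ≢ t → contract (A s) (B t) (C s) (A t) ≡ 0ᴹ
    contract-offDiagonal {s} {t} s≢t = entry-injective λ i j →
      -- The scalars left over from N_s N_t come from `B s` and `C t`, whereas `B t` and `C s` sit
      -- inside the contraction.
      let q , k , B≡1 = ≢0ᴹ⇒∃entry (B≢0 s)
          p , m , C≡1 = ≢0ᴹ⇒∃entry (C≢0 t)
          K = contract (A s) (B t) (C s) (A t)
      in begin
      entry K i j
        ≡⟨ cong₂ (λ b c → (b *₂ c) *₂ entry K i j) B≡1 C≡1 ⟨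
      (entry (B s) q k *₂ entry (C t) p m) *₂ entry K i j
        ≡⟨ contract-orthogonal s t i k q p m j ⟩
      δ s t *₂ (entry (A t) i j *₂ entry (B t) q k *₂ entry (C t) p m)
        ≡⟨ cong (_*₂ (entry (A t) i j *₂ entry (B t) q k *₂ entry (C t) p m)) (dec-false (s ≟ t) s≢t) ⟩
      0#
        ≡⟨ entry-0ᴹ i j ⟨
      entry 0ᴹ i j ∎

    invertible-unique : ∀ s t → Invertible (A s) → Invertible (A t) → s ≡ t
    invertible-unique s t (Aₛ⁻¹ , AₛAₛ⁻¹≡1 , Aₛ⁻¹Aₛ≡1) (Aₜ⁻¹ , AₜAₜ⁻¹≡1 , _) with s ≟ t
    ... | yes s≡t = s≡t
    ... | no s≢t = contradiction Bₜ≡0 (B≢0 t)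
      where
      AₛBₛCₛᵀ≡1 : (A s *ᴹ B s) *ᴹ C s ᵀ ≡ 1ᴹ
      AₛBₛCₛᵀ≡1 = *ᴹ-cancelʳ (A s) Aₛ⁻¹ ((A s *ᴹ B s) *ᴹ C s ᵀ) 1ᴹ AₛAₛ⁻¹≡1
        (trans (contract-diagonal s) (sym (*ᴹ-identityˡ (A s))))

      AₛBₜCₛᵀ≡0 : (A s *ᴹ B t) *ᴹ C s ᵀ ≡ 0ᴹ
      AₛBₜCₛᵀ≡0 = *ᴹ-cancelʳ (A t) Aₜ⁻¹ ((A s *ᴹ B t) *ᴹ C s ᵀ) 0ᴹ AₜAₜ⁻¹≡1
        (trans (contract-offDiagonal s≢t) (sym (*ᴹ-zeroˡ (A t))))

      AₛBₜ≡0 : A s *ᴹ B t ≡ 0ᴹ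
      AₛBₜ≡0 = *ᴹ-cancelʳ (C s ᵀ) (A s *ᴹ B s) (A s *ᴹ B t) 0ᴹ
        -- The product A_s B_s is a left inverse of C_sᵀ, hence also a right inverse, which allows
        -- cancelling C_sᵀ on the right.
        (*ᴹ≡1ᴹ-comm refl (A s *ᴹ B s) (C s ᵀ) AₛBₛCₛᵀ≡1)
        (trans AₛBₜCₛᵀ≡0 (sym (*ᴹ-zeroˡ (C s ᵀ))))

      Bₜ≡0 : B t ≡ 0ᴹ
      Bₜ≡0 = *ᴹ-cancelˡ (A s) Aₛ⁻¹ (B t) 0ᴹ Aₛ⁻¹Aₛ≡1
        (trans AₛBₜ≡0 (sym (*ᴹ-zeroʳ (A s))))

proposition5p3 : (r : ℕ) (A B C : Fin r → V) →
    T⟨3,3,3⟩ ≈ᵀ ∑ᵀ (λ t → A t ⊗ B t ⊗ C t) →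
    (∀ t → A t ≢ 0ᴹ) → (∀ t → B t ≢ 0ᴹ) → (∀ t → C t ≢ 0ᴹ) →
    ∑ℕ (λ t → rank (A t)) ≡ 27 →
    ∀ s t → Invertible (A s) → Invertible (A t) → s ≡ t
proposition5p3 r A B C T≈ _ B≢0 C≢0 ∑rank≡27 =
  invertible-unique A B C ∑flatten≡δ (λ t → rank (A t))
    (λ t → proj₁ (rankFactorization (A t)))
    (λ t → proj₁ (proj₂ (rankFactorization (A t))))
    (λ t → proj₂ (proj₂ (rankFactorization (A t))))
    -- The bound 27 is `cube 3` by computation, which makes Φ and Ψ square.
    ∑rank≡27 B≢0 C≢0
  where
  ∑flatten≡δ : ∀ a b → ∑₂ (λ t → flatten (A t) (B t) (C t) (ι {3} a) (ι {3} b)) ≡ δ a b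
  -- By definition, `flattenᵀ` of `A t ⊗ B t ⊗ C t` is `flatten (A t) (B t) (C t)`, so the
  -- decomposition is read off at regrouped indices.
  ∑flatten≡δ a b = trans (sym (T≈ _ _ _)) (flatten-T⟨3,3,3⟩ a b)
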